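{- Let $H=(V,E,w)$ be a weighted undirected hypergraph, and let $G=(V,\tilde E)$ be the underlying graph of $H$, where a pair of vertices $\tilde e$ is an edge, $\tilde e\in\tilde E$, if and only if there exists $e\in E$ such that $\tilde e\subset e$ (i.e. $e$ contains both endpoints of $\tilde e$). For each edge $\tilde e$ in $G$, define its weight by $$w_G(\tilde e)=\min_{\{e\in E:\ e\supseteq\tilde e\}} w(e).$$ Let $L^*$ and $L_G^*$ be shortest paths from $u\in V$ to $v\in V$ in $H$ and $G$, respectively. Then $$w(L^*)=w_G(L_G^*).$$
   Context: A weighted undirected hypergraph $H=(V,E,w)$ consists of a finite set $V$, a family $E$ of nonempty subsets of $V$ (hyperedges) with $\bigcup_{e\in E}e=V$, and a weight function $w:E\to\mathbb{R}^+\cup\{0\}$. A hyperpath (path in $H$) between $u$ and $v$ is a sequence of hyperedges $L=\{e_0,\dots,e_m\}$ with $u\in e_0$, $v\in e_m$ and $e_i\cap e_{i+1}\neq\emptyset$ for $i=0,\dots,m-1$; its weight is $w(L)=\sum_{i=0}^m w(e_i)$. The weight $w_G(L_G)$ of a path $L_G$ in $G$ is the sum of the weights $w_G$ of its edges. A shortest path is one of minimum weight. If $u=v$, the empty path is the shortest path, with weight $0$, in both $H$ and $G$. Edges of $G$ are 2-element subsets of $V$; the inclusion $\tilde e\subset e$ is not required to be strict. -}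

module Defs where

open import Data.Nat as ℕ using (ℕ)
import Data.Nat.Properties as ℕ
open import Data.Fin using (Fin)
open import Data.Fin.Subset
  using (Subset; ⊤; ⁅_⁆; _∪_; _∩_; ⋃; _∈_; _⊆_; Nonempty; ∣_∣)
open import Data.Fin.Subset.Properties using (_⊆?_)
open import Data.List using (List; []; _∷_; map; foldr; filter; allFin; tabulate; last)
open import Data.List.Relation.Unary.Linked using (Linked)
open import Data.Maybe.Relation.Unary.Any using (Any)
open import Data.Product using (∃; _×_; _,_)
open import Data.Rational as ℚ using (ℚ; 0ℚ; ½)
import Data.Rational.Properties as ℚ
open import Data.Rational.Solver using (module +-*-Solver)
open import Data.Sum using (inj₁; inj₂)
open import Relation.Binary.PropositionalEquality
  using (_≡_; refl; sym; trans; cong; subst; subst₂)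

∣p-q∣≤ε⇒p≤q+ε : ∀ p q {ε} → ℚ.∣ p ℚ.- q ∣ ℚ.≤ ε → p ℚ.≤ q ℚ.+ ε
∣p-q∣≤ε⇒p≤q+ε p q {ε} h =
  subst (ℚ._≤ q ℚ.+ ε) (rearrange p q)
    (ℚ.+-monoʳ-≤ q (ℚ.≤-trans (p≤∣p∣ (p ℚ.- q)) h))
  where
  open +-*-Solver
  rearrange : ∀ p q → q ℚ.+ (p ℚ.- q) ≡ p
  rearrange = solve 2 (λ p q → q :+ (p :- q) := p) refl
  p≤∣p∣ : ∀ p → p ℚ.≤ ℚ.∣ p ∣
  p≤∣p∣ p with ℚ.≤-total 0ℚ p
  ... | inj₁ 0≤p = ℚ.≤-reflexive (sym (ℚ.0≤p⇒∣p∣≡p 0≤p))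
  ... | inj₂ p≤0 = ℚ.≤-trans p≤0 (ℚ.nonNegative⁻¹ ℚ.∣ p ∣ {{ℚ.∣-∣-nonNeg p}})

p≤q+ε⇒∣p-q∣≤ε : ∀ p q {ε} → p ℚ.≤ q ℚ.+ ε → q ℚ.≤ p ℚ.+ ε → ℚ.∣ p ℚ.- q ∣ ℚ.≤ ε
p≤q+ε⇒∣p-q∣≤ε p q {ε} h k with ℚ.∣p∣≡p∨∣p∣≡-p (p ℚ.- q)
... | inj₁ eq = subst₂ ℚ._≤_ (sym eq) (cancel q ε) (ℚ.+-monoˡ-≤ (ℚ.- q) h)
  where
  open +-*-Solver
  cancel : ∀ q ε → q ℚ.+ ε ℚ.- q ≡ ε
  cancel = solve 2 (λ q ε → q :+ ε :- q := ε) refl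
... | inj₂ eq = subst₂ ℚ._≤_ (trans (swap p q) (sym eq)) (cancel p ε) (ℚ.+-monoˡ-≤ (ℚ.- p) k)
  where
  open +-*-Solver
  swap : ∀ p q → q ℚ.- p ≡ ℚ.- (p ℚ.- q)
  swap = solve 2 (λ p q → q :- p := :- (p :- q)) refl
  cancel : ∀ p ε → p ℚ.+ ε ℚ.- p ≡ ε
  cancel = solve 2 (λ p ε → p :+ ε :- p := ε) refl

-- Real numbers as Cauchy sequences of rationals, with setoid equality _≈_
-- in place of the quotient by null sequences.

IsCauchy : (ℕ → ℚ) → Set
IsCauchy f = ∀ ε → 0ℚ ℚ.< ε → ∃ λ N → ∀ m n → N ℕ.≤ m → N ℕ.≤ n →
  ℚ.∣ f m ℚ.- f n ∣ ℚ.≤ ε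

record ℝ : Set where
  constructor mkℝ
  field
    seq    : ℕ → ℚ
    cauchy : IsCauchy seq

open ℝ public

infix  4 _≈_ _≤_
infixl 6 _+_
infixl 7 _⊓_

_≈_ : ℝ → ℝ → Set
x ≈ y = ∀ ε → 0ℚ ℚ.< ε → ∃ λ N → ∀ n → N ℕ.≤ n →
  ℚ.∣ seq x n ℚ.- seq y n ∣ ℚ.≤ ε

_≤_ : ℝ → ℝ → Set
x ≤ y = ∀ ε → 0ℚ ℚ.< ε → ∃ λ N → ∀ n → N ℕ.≤ n →
  seq x n ℚ.≤ seq y n ℚ.+ ε

0ℝ : ℝ
0ℝ = mkℝ (λ _ → 0ℚ) (λ ε 0<ε → 0 , λ _ _ _ _ → ℚ.<⇒≤ 0<ε)

_+_ : ℝ → ℝ → ℝ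
x + y = mkℝ (λ n → seq x n ℚ.+ seq y n) +-cauchy
  where
  open +-*-Solver
  0<½ε : ∀ ε → 0ℚ ℚ.< ε → 0ℚ ℚ.< ½ ℚ.* ε
  0<½ε ε 0<ε = subst (ℚ._< ½ ℚ.* ε) (ℚ.*-zeroʳ ½) (ℚ.*-monoʳ-<-pos ½ 0<ε)
  regroup : ∀ a b c d → (a ℚ.- c) ℚ.+ (b ℚ.- d) ≡ (a ℚ.+ b) ℚ.- (c ℚ.+ d)
  regroup = solve 4 (λ a b c d → (a :- c) :+ (b :- d) := (a :+ b) :- (c :+ d)) refl
  halves : ∀ ε → ½ ℚ.* ε ℚ.+ ½ ℚ.* ε ≡ ε
  halves = solve 1 (λ ε → con ½ :* ε :+ con ½ :* ε := ε) refl
  +-cauchy : IsCauchy (λ n → seq x n ℚ.+ seq y n)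
  +-cauchy ε 0<ε with cauchy x (½ ℚ.* ε) (0<½ε ε 0<ε) | cauchy y (½ ℚ.* ε) (0<½ε ε 0<ε)
  ... | M , hx | N , hy = M ℕ.⊔ N , λ m n p q →
    subst₂ ℚ._≤_
      (cong ℚ.∣_∣ (regroup (seq x m) (seq y m) (seq x n) (seq y n))) (halves ε)
      (ℚ.≤-trans (ℚ.∣p+q∣≤∣p∣+∣q∣ (seq x m ℚ.- seq x n) (seq y m ℚ.- seq y n))
        (ℚ.+-mono-≤
          (hx m n (ℕ.m⊔n≤o⇒m≤o M N p) (ℕ.m⊔n≤o⇒m≤o M N q))
          (hy m n (ℕ.m⊔n≤o⇒n≤o M N p) (ℕ.m⊔n≤o⇒n≤o M N q))))

_⊓_ : ℝ → ℝ → ℝ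
x ⊓ y = mkℝ (λ n → seq x n ℚ.⊓ seq y n) ⊓-cauchy
  where
  ⊓-shift : ∀ a b c d {ε} → a ℚ.≤ c ℚ.+ ε → b ℚ.≤ d ℚ.+ ε → a ℚ.⊓ b ℚ.≤ (c ℚ.⊓ d) ℚ.+ ε
  ⊓-shift a b c d {ε} h k =
    subst (a ℚ.⊓ b ℚ.≤_)
      (sym (ℚ.mono-≤-distrib-⊓ {λ z → z ℚ.+ ε} (ℚ.+-monoˡ-≤ ε) c d))
      (ℚ.⊓-mono-≤ h k)
  ⊓-cauchy : IsCauchy (λ n → seq x n ℚ.⊓ seq y n)
  ⊓-cauchy ε 0<ε with cauchy x ε 0<ε | cauchy y ε 0<ε
  ... | M , hx | N , hy = M ℕ.⊔ N , λ m n p q →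
    let a = seq x m; b = seq y m
        c = seq x n; d = seq y n
        pM = ℕ.m⊔n≤o⇒m≤o M N p; qM = ℕ.m⊔n≤o⇒m≤o M N q
        pN = ℕ.m⊔n≤o⇒n≤o M N p; qN = ℕ.m⊔n≤o⇒n≤o M N q
    in p≤q+ε⇒∣p-q∣≤ε (a ℚ.⊓ b) (c ℚ.⊓ d)
         (⊓-shift a b c d
           (∣p-q∣≤ε⇒p≤q+ε a c (hx m n pM qM)) (∣p-q∣≤ε⇒p≤q+ε b d (hy m n pN qN)))
         (⊓-shift c d a b
           (∣p-q∣≤ε⇒p≤q+ε c a (hx n m qM pM)) (∣p-q∣≤ε⇒p≤q+ε d b (hy n m qN pN)))

sumℝ : List ℝ → ℝ
sumℝ = foldr _+_ 0ℝ

-- The vertex set is Fin order; the hyperedges form a family indexed by Fin size.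
record Hypergraph : Set where
  field
    order     : ℕ
    size      : ℕ
    hyperedge : Fin size → Subset order
    nonempty  : ∀ e → Nonempty (hyperedge e)
    covering  : ⋃ (tabulate hyperedge) ≡ ⊤
    weight    : Fin size → ℝ
    weight≥0  : ∀ e → 0ℝ ≤ weight e

  Vertex : Set
  Vertex = Fin order

module _ (H : Hypergraph) where
  open Hypergraph H

  -- The empty sequence is a hyperpath exactly from a vertex to itself.
  IsHyperpath : Vertex → Vertex → List (Fin size) → Set
  IsHyperpath u v []         = u ≡ v
  IsHyperpath u v (e₀ ∷ es) =
    u ∈ hyperedge e₀ ×
    Any (λ eₘ → v ∈ hyperedge eₘ) (last (e₀ ∷ es)) ×
    Linked (λ e e′ → Nonempty (hyperedge e ∩ hyperedge e′)) (e₀ ∷ es)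

  hyperpathWeight : List (Fin size) → ℝ
  hyperpathWeight L = sumℝ (map weight L)

  IsShortestHyperpath : Vertex → Vertex → List (Fin size) → Set
  IsShortestHyperpath u v L =
    IsHyperpath u v L ×
    (∀ L′ → IsHyperpath u v L′ → hyperpathWeight L ≤ hyperpathWeight L′)

  IsEdge : Subset order → Set
  IsEdge ẽ = ∣ ẽ ∣ ≡ 2 × ∃ λ e → ẽ ⊆ hyperedge e

  -- The minimum of the weights of all hyperedges containing ẽ. The fold starts
  -- at a hyperedge known to contain ẽ, which also occurs in the filtered list.
  edgeWeight : ∀ ẽ → IsEdge ẽ → ℝ
  edgeWeight ẽ (_ , e , _) =
    foldr _⊓_ (weight e) (map weight (filter (λ e′ → ẽ ⊆? hyperedge e′) (allFin size)))

  infixr 5 _∷_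

  -- As for hyperpaths, repetitions are allowed. IsEdge forces the two
  -- endpoints of each step to be distinct.
  data Path : Vertex → Vertex → Set where
    []  : ∀ {v} → Path v v
    _∷_ : ∀ {u x v} → IsEdge (⁅ u ⁆ ∪ ⁅ x ⁆) → Path x v → Path u v

  pathWeight : ∀ {u v} → Path u v → ℝ
  pathWeight []                  = 0ℝ
  pathWeight (_∷_ {u} {x} ux L) = edgeWeight (⁅ u ⁆ ∪ ⁅ x ⁆) ux + pathWeight L

  IsShortestPath : ∀ {u v} → Path u v → Set
  IsShortestPath {u} {v} L = ∀ (L′ : Path u v) → pathWeight L ≤ pathWeight L′

{-# OPTIONS --safe #-}

-- A hyperpath becomes a path in G of no larger weight by choosing a vertex in
-- each intersection of consecutive hyperedges and skipping the steps whose two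
-- endpoints coincide.  For the converse, the hyperedge attaining an edge weight
-- cannot be selected constructively, since _≤_ on ℝ is undecidable.  Instead, a
-- lower bound c for all hyperpath weights is carried along the path in G:
-- c ≤ s + a + t and c ≤ s + b + t give c ≤ s + (a ⊓ b) + t.

module Submission where

open import Defs
open import Data.Fin using (Fin; _≟_)
open import Data.Fin.Subset using (Subset; ⁅_⁆; _∪_; _∈_; _⊆_; ∣_∣)
open import Data.Fin.Subset.Properties
  using (_⊆?_; x∈⁅x⁆; x∈⁅y⁆⇒x≡y; x∈p∪q⁺; x∈p∪q⁻; x∈p∩q⁺; x∈p∩q⁻;
         ∣⁅x⁆∣≡1; ∪-identityˡ; ∪-identityʳ)
open import Data.List using (List; []; _∷_; map; foldr; filter; allFin)
open import Data.List.Relation.Unary.All using (All; []; _∷_)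
import Data.List.Relation.Unary.All as All
import Data.List.Relation.Unary.All.Properties as All
open import Data.List.Relation.Unary.Linked using ([-]; _∷_)
open import Data.Maybe.Relation.Unary.Any using (just)
open import Data.Nat as ℕ using (suc)
import Data.Nat.Properties as ℕ
open import Data.Product using (∃; _,_)
open import Data.Rational as ℚ using (0ℚ; ½)
import Data.Rational.Properties as ℚ
open import Data.Rational.Solver using (module +-*-Solver)
open import Data.Sum using (inj₁; inj₂)
open import Function using (_∘_)
open import Relation.Nullary using (yes; no; contradiction)
open import Relation.Binary.PropositionalEquality
  using (_≡_; _≢_; refl; sym; trans; cong; subst)

private
  ½*-pos : ∀ {ε} → 0ℚ ℚ.< ε → 0ℚ ℚ.< ½ ℚ.* ε
  ½*-pos {ε} 0<ε = subst (ℚ._< ½ ℚ.* ε) (ℚ.*-zeroʳ ½) (ℚ.*-monoʳ-<-pos ½ 0<ε)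

  +-halves : ∀ p q ε → (p ℚ.+ ½ ℚ.* ε) ℚ.+ (q ℚ.+ ½ ℚ.* ε) ≡ (p ℚ.+ q) ℚ.+ ε
  +-halves = solve 3 (λ p q ε →
    (p :+ con ½ :* ε) :+ (q :+ con ½ :* ε) := (p :+ q) :+ ε) refl
    where open +-*-Solver

  +-halves′ : ∀ p ε → (p ℚ.+ ½ ℚ.* ε) ℚ.+ ½ ℚ.* ε ≡ p ℚ.+ ε
  +-halves′ = solve 2 (λ p ε → (p :+ con ½ :* ε) :+ con ½ :* ε := p :+ ε) refl
    where open +-*-Solver

-- Reduces the algebraic laws below to rational facts that hold at every index, so the threshold can
-- be `0` for any `ε`.
≤-pointwise : ∀ {x y} → (∀ n → seq x n ℚ.≤ seq y n) → x ≤ y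
≤-pointwise {x} {y} h ε 0<ε = 0 , λ n _ → ℚ.≤-trans (h n)
  (subst (ℚ._≤ seq y n ℚ.+ ε) (ℚ.+-identityʳ (seq y n))
    (ℚ.+-monoʳ-≤ (seq y n) (ℚ.<⇒≤ 0<ε)))

≤-refl : ∀ {x} → x ≤ x
≤-refl {x} = ≤-pointwise {x} {x} (λ _ → ℚ.≤-refl)

≤-trans : ∀ {x y z} → x ≤ y → y ≤ z → x ≤ z
≤-trans {x} {y} {z} x≤y y≤z ε 0<ε
  with x≤y (½ ℚ.* ε) (½*-pos 0<ε) | y≤z (½ ℚ.* ε) (½*-pos 0<ε)
... | M , h | N , k = M ℕ.⊔ N , λ n p →
  subst (seq x n ℚ.≤_) (+-halves′ (seq z n) ε)
    (ℚ.≤-trans (h n (ℕ.m⊔n≤o⇒m≤o M N p))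
      (ℚ.+-monoˡ-≤ (½ ℚ.* ε) (k n (ℕ.m⊔n≤o⇒n≤o M N p))))

≤-antisym : ∀ {x y} → x ≤ y → y ≤ x → x ≈ y
≤-antisym {x} {y} x≤y y≤x ε 0<ε with x≤y ε 0<ε | y≤x ε 0<ε
... | M , h | N , k = M ℕ.⊔ N , λ n p →
  p≤q+ε⇒∣p-q∣≤ε (seq x n) (seq y n)
    (h n (ℕ.m⊔n≤o⇒m≤o M N p)) (k n (ℕ.m⊔n≤o⇒n≤o M N p))

+-mono-≤ : ∀ {x y z w} → x ≤ y → z ≤ w → x + z ≤ y + w
+-mono-≤ {x} {y} {z} {w} x≤y z≤w ε 0<ε
  with x≤y (½ ℚ.* ε) (½*-pos 0<ε) | z≤w (½ ℚ.* ε) (½*-pos 0<ε)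
... | M , h | N , k = M ℕ.⊔ N , λ n p →
  subst (seq x n ℚ.+ seq z n ℚ.≤_) (+-halves (seq y n) (seq w n) ε)
    (ℚ.+-mono-≤ (h n (ℕ.m⊔n≤o⇒m≤o M N p)) (k n (ℕ.m⊔n≤o⇒n≤o M N p)))

+-assoc-≤ : ∀ x y z → (x + y) + z ≤ x + (y + z)
+-assoc-≤ x y z = ≤-pointwise {(x + y) + z} {x + (y + z)}
  (λ n → ℚ.≤-reflexive (ℚ.+-assoc (seq x n) (seq y n) (seq z n)))

+-assoc-≥ : ∀ x y z → x + (y + z) ≤ (x + y) + z
+-assoc-≥ x y z = ≤-pointwise {x + (y + z)} {(x + y) + z}
  (λ n → ℚ.≤-reflexive (sym (ℚ.+-assoc (seq x n) (seq y n) (seq z n))))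

+-identityˡ-≤ : ∀ x → 0ℝ + x ≤ x
+-identityˡ-≤ x = ≤-pointwise {0ℝ + x} {x} (λ n → ℚ.≤-reflexive (ℚ.+-identityˡ (seq x n)))

+-identityˡ-≥ : ∀ x → x ≤ 0ℝ + x
+-identityˡ-≥ x = ≤-pointwise {x} {0ℝ + x}
  (λ n → ℚ.≤-reflexive (sym (ℚ.+-identityˡ (seq x n))))

x⊓y≤y : ∀ x y → x ⊓ y ≤ y
x⊓y≤y x y = ≤-pointwise {x ⊓ y} {y} (λ n → ℚ.p⊓q≤q (seq x n) (seq y n))

-- The minimum of two rationals is always one of them, so the case split happens separately at each
-- index. Beyond `M ℕ.⊔ N` both hypotheses are available, and which argument is selected may vary
-- with `n`.
⊓-glb-+ : ∀ {c} s t x y → c ≤ s + x + t → c ≤ s + y + t → c ≤ s + (x ⊓ y) + t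
⊓-glb-+ {c} s t x y c≤x c≤y ε 0<ε with c≤x ε 0<ε | c≤y ε 0<ε
... | M , h | N , k = M ℕ.⊔ N , bound
  where
  bound : ∀ n → M ℕ.⊔ N ℕ.≤ n → seq c n ℚ.≤ seq (s + (x ⊓ y) + t) n ℚ.+ ε
  bound n p with ℚ.⊓-sel (seq x n) (seq y n)
  ... | inj₁ eq rewrite eq = h n (ℕ.m⊔n≤o⇒m≤o M N p)
  ... | inj₂ eq rewrite eq = k n (ℕ.m⊔n≤o⇒n≤o M N p)

foldr-⊓≤init : ∀ x xs → foldr _⊓_ x xs ≤ x
foldr-⊓≤init x []       = ≤-refl {x}
foldr-⊓≤init x (y ∷ xs) = ≤-trans {y ⊓ foldr _⊓_ x xs} {foldr _⊓_ x xs} {x}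
  (x⊓y≤y y (foldr _⊓_ x xs)) (foldr-⊓≤init x xs)

foldr-⊓-glb-+ : ∀ {c} s t x {xs} → c ≤ s + x + t → All (λ y → c ≤ s + y + t) xs →
  c ≤ s + foldr _⊓_ x xs + t
foldr-⊓-glb-+ s t x c≤x [] = c≤x
foldr-⊓-glb-+ {c} s t x {y ∷ xs} c≤x (c≤y ∷ c≤xs) =
  ⊓-glb-+ {c} s t y (foldr _⊓_ x xs) c≤y (foldr-⊓-glb-+ {c} s t x c≤x c≤xs)

∣⁅x⁆∪⁅y⁆∣≡2 : ∀ {n} {x y : Fin n} → x ≢ y → ∣ ⁅ x ⁆ ∪ ⁅ y ⁆ ∣ ≡ 2
∣⁅x⁆∪⁅y⁆∣≡2 {x = Fin.zero}  {Fin.zero}  x≢y = contradiction refl x≢y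
∣⁅x⁆∪⁅y⁆∣≡2 {x = Fin.zero}  {Fin.suc y} x≢y =
  cong suc (trans (cong ∣_∣ (∪-identityˡ ⁅ y ⁆)) (∣⁅x⁆∣≡1 y))
∣⁅x⁆∪⁅y⁆∣≡2 {x = Fin.suc x} {Fin.zero}  x≢y =
  cong suc (trans (cong ∣_∣ (∪-identityʳ ⁅ x ⁆)) (∣⁅x⁆∣≡1 x))
∣⁅x⁆∪⁅y⁆∣≡2 {x = Fin.suc x} {Fin.suc y} x≢y = ∣⁅x⁆∪⁅y⁆∣≡2 (x≢y ∘ cong Fin.suc)

⁅x⁆∪⁅y⁆⊆p : ∀ {n} {x y : Fin n} {p : Subset n} → x ∈ p → y ∈ p → ⁅ x ⁆ ∪ ⁅ y ⁆ ⊆ p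
⁅x⁆∪⁅y⁆⊆p {x = x} {y} {p} x∈p y∈p z∈ with x∈p∪q⁻ ⁅ x ⁆ ⁅ y ⁆ z∈
... | inj₁ z∈x = subst (_∈ p) (sym (x∈⁅y⁆⇒x≡y x z∈x)) x∈p
... | inj₂ z∈y = subst (_∈ p) (sym (x∈⁅y⁆⇒x≡y y z∈y)) y∈p

module _ (H : Hypergraph) where
  open Hypergraph H

  -- The hyperedge stored in the `IsEdge` proof is the starting value of the fold. Storing `e` there
  -- gives the bound without locating `e` in the filtered list.
  edgeWeight≤weight : ∀ {ẽ} (∣ẽ∣≡2 : ∣ ẽ ∣ ≡ 2) e (ẽ⊆e : ẽ ⊆ hyperedge e) →
    edgeWeight H ẽ (∣ẽ∣≡2 , e , ẽ⊆e) ≤ weight e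
  edgeWeight≤weight {ẽ} _ e _ =
    foldr-⊓≤init (weight e)
      (map weight (filter (λ e′ → ẽ ⊆? hyperedge e′) (allFin size)))

  prependStep : ∀ {u x v} e → u ∈ hyperedge e → x ∈ hyperedge e → (P : Path H x v) →
    ∃ λ (Q : Path H u v) → pathWeight H Q ≤ weight e + pathWeight H P
  prependStep {u} {x} e u∈e x∈e P with u ≟ x
  -- `G` has no loops, so the step is dropped; nonnegativity of `weight e` pays for it.
  ... | yes refl = P ,
    ≤-trans {pathWeight H P} {0ℝ + pathWeight H P} {weight e + pathWeight H P}
      (+-identityˡ-≥ (pathWeight H P))
      (+-mono-≤ {0ℝ} {weight e} {pathWeight H P} {pathWeight H P}
        (weight≥0 e) (≤-refl {pathWeight H P}))
  ... | no u≢x = ux ∷ P ,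
    +-mono-≤ {edgeWeight H (⁅ u ⁆ ∪ ⁅ x ⁆) ux} {weight e} {pathWeight H P} {pathWeight H P}
      (edgeWeight≤weight ∣ux∣≡2 e ux⊆e) (≤-refl {pathWeight H P})
    where
    ∣ux∣≡2 : ∣ ⁅ u ⁆ ∪ ⁅ x ⁆ ∣ ≡ 2
    ∣ux∣≡2 = ∣⁅x⁆∪⁅y⁆∣≡2 u≢x
    ux⊆e : ⁅ u ⁆ ∪ ⁅ x ⁆ ⊆ hyperedge e
    ux⊆e = ⁅x⁆∪⁅y⁆⊆p u∈e x∈e
    ux : IsEdge H (⁅ u ⁆ ∪ ⁅ x ⁆)
    ux = ∣ux∣≡2 , e , ux⊆e

  hyperpath⇒path : ∀ {u v} L → IsHyperpath H u v L →
    ∃ λ (P : Path H u v) → pathWeight H P ≤ hyperpathWeight H L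
  hyperpath⇒path [] refl = [] , ≤-refl {0ℝ}
  -- The last hyperedge contains both the current vertex and `v`, so one step within it finishes the
  -- path.
  hyperpath⇒path (e ∷ []) (u∈e , just v∈e , _) = prependStep e u∈e v∈e []
  hyperpath⇒path (e ∷ L@(e′ ∷ _)) (u∈e , v∈last , (x , x∈e∩e′) ∷ linked) =
    let x∈e , x∈e′ = x∈p∩q⁻ (hyperedge e) (hyperedge e′) x∈e∩e′
        P , P≤L    = hyperpath⇒path L (x∈e′ , v∈last , linked)
        Q , Q≤e+P  = prependStep e u∈e x∈e P
    in Q ,
      ≤-trans {pathWeight H Q} {weight e + pathWeight H P} {weight e + hyperpathWeight H L}
        Q≤e+P
        (+-mono-≤ {weight e} {weight e} {pathWeight H P} {hyperpathWeight H L}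
          (≤-refl {weight e}) P≤L)

  -- The shared vertex `x` witnesses that `e` meets the first hyperedge of `L`. When `L` is empty,
  -- `x` is `v`, so `e` itself reaches the target.
  prependHyperedge : ∀ {u x v} e L → u ∈ hyperedge e → x ∈ hyperedge e →
    IsHyperpath H x v L → IsHyperpath H u v (e ∷ L)
  prependHyperedge e []       u∈e x∈e refl                      = u∈e , just x∈e , [-]
  prependHyperedge e (e′ ∷ L) u∈e x∈e (x∈e′ , v∈last , linked) =
    u∈e , v∈last , (_ , x∈p∩q⁺ (x∈e , x∈e′)) ∷ linked

  edgeWeight-glb-+ : ∀ {c} s t {ẽ} (p : IsEdge H ẽ) →
    (∀ e → ẽ ⊆ hyperedge e → c ≤ s + weight e + t) → c ≤ s + edgeWeight H ẽ p + t
  edgeWeight-glb-+ {c} s t {ẽ} (_ , e , ẽ⊆e) h =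
    foldr-⊓-glb-+ {c} s t (weight e) (h e ẽ⊆e)
      -- Every entry that survives the filter contains `ẽ`, which is what `h` asks for.
      (All.map⁺ (All.map (λ {e′} → h e′)
        (All.all-filter (λ e′ → ẽ ⊆? hyperedge e′) (allFin size))))

  -- The accumulator `s` stands for the weight of the hyperedges already chosen for earlier steps.
  -- For each `e` containing the first edge, the induction hypothesis at `s + weight e` replaces
  -- hyperpaths from `x` by the tail `P`; only then is the minimum over `e` taken. No minimizing
  -- hyperedge is ever named.
  path-glb : ∀ {c u v} s (P : Path H u v) →
    (∀ L → IsHyperpath H u v L → c ≤ s + hyperpathWeight H L) → c ≤ s + pathWeight H P
  path-glb s [] h = h [] refl
  path-glb {c} s (_∷_ {u} {x} ux P) h =
    ≤-trans {c} {s + w + pathWeight H P} {s + (w + pathWeight H P)}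
      (edgeWeight-glb-+ {c} s (pathWeight H P) ux λ e ux⊆e →
        path-glb {c} (s + weight e) P λ L L-path →
          ≤-trans {c} {s + (weight e + hyperpathWeight H L)} {s + weight e + hyperpathWeight H L}
            (h (e ∷ L) (prependHyperedge e L
              (ux⊆e (x∈p∪q⁺ (inj₁ (x∈⁅x⁆ u)))) (ux⊆e (x∈p∪q⁺ (inj₂ (x∈⁅x⁆ x)))) L-path))
            (+-assoc-≥ s (weight e) (hyperpathWeight H L)))
      (+-assoc-≤ s w (pathWeight H P))
    where w = edgeWeight H (⁅ u ⁆ ∪ ⁅ x ⁆) ux

theorem3 : (H : Hypergraph) (u v : Hypergraph.Vertex H)
    (L* : List (Fin (Hypergraph.size H))) (LG* : Path H u v) →
    IsShortestHyperpath H u v L* → IsShortestPath H LG* →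
    hyperpathWeight H L* ≈ pathWeight H LG*
theorem3 H u v L* LG* (L*-path , L*-min) LG*-min =
  let P , P≤L* = hyperpath⇒path H L* L*-path
  in ≤-antisym {hyperpathWeight H L*} {pathWeight H LG*}
    (≤-trans {hyperpathWeight H L*} {0ℝ + pathWeight H LG*} {pathWeight H LG*}
      -- Initially no hyperedge is chosen, hence `0ℝ`; minimality of `L*` makes its weight the
      -- required lower bound.
      (path-glb H {hyperpathWeight H L*} 0ℝ LG* λ L L-path →
        ≤-trans {hyperpathWeight H L*} {hyperpathWeight H L} {0ℝ + hyperpathWeight H L}
          (L*-min L L-path) (+-identityˡ-≥ (hyperpathWeight H L)))
      (+-identityˡ-≤ (pathWeight H LG*)))
    (≤-trans {pathWeight H LG*} {pathWeight H P} {hyperpathWeight H L*}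
      (LG*-min P) P≤L*)
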